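{- In the Fireball Calculus: (1) every closed $\to_{\mathtt f}$-normal term is a fireball; (2) $\to_{\mathtt f}$ is deterministic.
   Context: Terms of the Fireball Calculus: $t,u ::= x\mid a\mid\lambda x.t\mid tu$, where $x$ ranges over variables and $a$ over a separate set of symbols (constants, never bound nor substituted). Terms are taken up to $\alpha$-equivalence; $t\{x\leftarrow u\}$ is capture-avoiding substitution; a term is closed if it has no free variables (symbols are allowed). Values $v::=\lambda x.t$; fireballs $f::=v\mid A$; inerts $A::=a\mid Af$. Evaluation contexts $F::=\langle\cdot\rangle\mid tF\mid Ff$. The reduction is $F\langle(\lambda x.t)f\rangle\to_{\mathtt f}F\langle t\{x\leftarrow f\}\rangle$, for $F$ an evaluation context and $f$ a fireball. Deterministic means that every term has at most one $\to_{\mathtt f}$-redex (hence at most one reduct). -}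

module Defs where

open import Data.Fin.Base using (Fin; suc)
open import Data.Fin.Substitution using (Sub; Lift; TermSubst; module Lift; module TermSubst)
open import Data.Nat.Base using (ℕ; suc)
open import Data.Product.Base using (_×_)
open import Data.Vec.Base using (lookup)
open import Relation.Binary.PropositionalEquality.Core using (_≡_)
open import Relation.Nullary.Negation.Core using (¬_)

module FireballCalculus (Sym : Set) where

  infixl 9 _·_

  -- Terms up to α-equivalence, as well-scoped de Bruijn terms: Term n is the
  -- type of terms whose free variables are among n given ones.
  data Term (n : ℕ) : Set where
    var : (x : Fin n) → Term n
    sym : (a : Sym) → Term n
    ƛ   : (t : Term (suc n)) → Term n
    _·_ : (t u : Term n) → Term n

  data _∈FV_ {n : ℕ} (x : Fin n) : Term n → Set where
    var      : x ∈FV var x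
    ƛ        : {t : Term (suc n)} → suc x ∈FV t → x ∈FV ƛ t
    function : {t u : Term n} → x ∈FV t → x ∈FV (t · u)
    argument : {t u : Term n} → x ∈FV u → x ∈FV (t · u)

  Closed : {n : ℕ} → Term n → Set
  Closed {n} t = (x : Fin n) → ¬ (x ∈FV t)

  module _ {T : ℕ → Set} (l : Lift T Term) where
    open Lift l using (lift; _↑)

    applySub : {m n : ℕ} → Term m → Sub T m n → Term n
    applySub (var x) ρ = lift (lookup ρ x)
    applySub (sym a) ρ = sym a
    applySub (ƛ t)   ρ = ƛ (applySub t (ρ ↑))
    applySub (t · u) ρ = applySub t ρ · applySub u ρ

  termSubst : TermSubst Term
  termSubst = record { var = var ; app = applySub }

  open TermSubst termSubst using (_/_; sub)

  -- t [ u ] is t{x←u}, where x is the variable bound by the λ in ƛ t.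
  _[_] : {n : ℕ} → Term (suc n) → Term n → Term n
  t [ u ] = t / sub u

  data Value {n : ℕ} : Term n → Set where
    ƛ : (t : Term (suc n)) → Value (ƛ t)

  mutual
    data Fireball {n : ℕ} : Term n → Set where
      value : {v : Term n} → Value v → Fireball v
      inert : {A : Term n} → Inert A → Fireball A

    data Inert {n : ℕ} : Term n → Set where
      sym : (a : Sym) → Inert (sym a)
      _·_ : {A f : Term n} → Inert A → Fireball f → Inert (A · f)

  -- Contexts whose hole is not under a λ; EvalCtx singles out the evaluation
  -- contexts F ::= ⟨·⟩ | t F | F f among them.
  data Ctx (n : ℕ) : Set where
    ⟨·⟩  : Ctx n
    _·ʳ_ : (t : Term n) (F : Ctx n) → Ctx n
    _·ˡ_ : (F : Ctx n) (u : Term n) → Ctx n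

  data EvalCtx {n : ℕ} : Ctx n → Set where
    ⟨·⟩  : EvalCtx ⟨·⟩
    _·ʳ_ : (t : Term n) {F : Ctx n} → EvalCtx F → EvalCtx (t ·ʳ F)
    _·ˡ_ : {F : Ctx n} {f : Term n} → EvalCtx F → Fireball f → EvalCtx (F ·ˡ f)

  _⟨_⟩ : {n : ℕ} → Ctx n → Term n → Term n
  ⟨·⟩      ⟨ s ⟩ = s
  (t ·ʳ F) ⟨ s ⟩ = t · (F ⟨ s ⟩)
  (F ·ˡ u) ⟨ s ⟩ = (F ⟨ s ⟩) · u

  infix 4 _→f_

  data _→f_ {n : ℕ} : Term n → Term n → Set where
    step : {F : Ctx n} {t : Term (suc n)} {f : Term n} →
           EvalCtx F → Fireball f → F ⟨ ƛ t · f ⟩ →f F ⟨ t [ f ] ⟩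

  record Redex {n : ℕ} (s : Term n) : Set where
    field
      ctx         : Ctx n
      body        : Term (suc n)
      arg         : Term n
      evalCtx     : EvalCtx ctx
      argFireball : Fireball arg
      decomposes  : s ≡ ctx ⟨ ƛ body · arg ⟩

  open Redex public

  -- Redexes are compared as occurrences: equal contexts and equal contents.
  AtMostOneRedex : {n : ℕ} → Term n → Set
  AtMostOneRedex s =
    (r r′ : Redex s) → ctx r ≡ ctx r′ × body r ≡ body r′ × arg r ≡ arg r′

{-# OPTIONS --safe #-}

-- Evaluation is right to left: in t · u the left part may be evaluated only
-- once u is a fireball. Fireballs contain no redex in evaluation position, so
-- the side on which a redex of t · u lies is forced, which gives uniqueness.
module Submission where

open import Data.Nat.Base using (ℕ)
open import Data.Product.Base using (_×_; _,_; ∃)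
open import Data.Sum.Base using (_⊎_; inj₁; inj₂)
open import Relation.Binary.PropositionalEquality.Core using (_≡_; refl; trans; subst) renaming (sym to ≡-sym)
open import Relation.Binary.Rewriting using (IsNormalForm; Deterministic)
open import Relation.Nullary.Negation.Core using (¬_; contradiction)
open import Defs

module _ {Sym : Set} where
  open FireballCalculus Sym

  private
    variable
      n : ℕ
      F G : Ctx n
      s s′ t t′ u u′ f f′ : Term n

  →f-·ʳ : (t : Term n) → u →f u′ → t · u →f t · u′
  →f-·ʳ t (step F f) = step (t ·ʳ F) f

  →f-·ˡ : t →f t′ → Fireball f → t · f →f t′ · f
  →f-·ˡ (step F f) g = step (F ·ˡ g) f

  -- Normality serves only to refute the second alternative, so the induction runs without it. An
  -- abstraction is already a fireball, hence closedness never has to pass under a binder.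
  progress : (t : Term n) → Closed t → Fireball t ⊎ ∃ (t →f_)
  progress (var x) closed = contradiction var (closed x)
  progress (sym a) closed = inj₁ (inert (sym a))
  progress (ƛ t)   closed = inj₁ (value (ƛ t))
  progress (t · u) closed
    with progress u (λ x x∈u → closed x (argument x∈u))
  ... | inj₂ (_ , u→u′) = inj₂ (_ , →f-·ʳ t u→u′)
  ... | inj₁ fu with progress t (λ x x∈t → closed x (function x∈t))
  ...   | inj₂ (_ , t→t′)     = inj₂ (_ , →f-·ˡ t→t′ fu)
  -- Both parts are now fireballs, and the shape of the left one decides: an abstraction makes a
  -- redex at the root, an inert absorbs its argument.
  ...   | inj₁ (value (ƛ _))  = inj₂ (_ , step ⟨·⟩ fu)
  ...   | inj₁ (inert A)      = inj₁ (inert (A · fu))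

  closed-normal⇒fireball : Closed t → IsNormalForm _→f_ t → Fireball t
  closed-normal⇒fireball {t = t} closed normal with progress t closed
  ... | inj₁ ft  = ft
  ... | inj₂ red = contradiction red normal

  -- An application can be a fireball only by being inert, so its left part is inert and its right
  -- part a fireball. Following the path of `F` down to the hole, the abstraction of the redex would
  -- have to be inert.
  redex-not-fireball : EvalCtx F → ¬ Fireball (F ⟨ ƛ t · f ⟩)
  redex-not-fireball ⟨·⟩      (inert (() · _))
  redex-not-fireball (t ·ʳ F) (inert (_ · fu)) = redex-not-fireball F fu
  redex-not-fireball (F ·ˡ _) (inert (A · _))  = redex-not-fireball F (inert A)

  -- Splits equations between plugged contexts, where unification would get stuck on `_⟨_⟩`.
  ·-injective : t · u ≡ t′ · u′ → t ≡ t′ × u ≡ u′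
  ·-injective refl = refl , refl

  redex-not-≡-fireball : EvalCtx F → Fireball f′ → ¬ (f′ ≡ F ⟨ ƛ t · f ⟩)
  redex-not-≡-fireball F f′ eq = redex-not-fireball F (subst Fireball eq f′)

  -- Simultaneous induction on the two contexts. Where they diverge, one redex would sit inside a
  -- fireball: the argument of the other redex, its abstraction, or the fireball to the right of a
  -- `_·ˡ_`.
  decomposition-unique : EvalCtx F → Fireball f → EvalCtx G → Fireball f′ →
                         F ⟨ ƛ t · f ⟩ ≡ G ⟨ ƛ t′ · f′ ⟩ →
                         F ≡ G × t ≡ t′ × f ≡ f′
  decomposition-unique ⟨·⟩ ff ⟨·⟩ fg refl = refl , refl , refl
  decomposition-unique ⟨·⟩ ff (_ ·ʳ G) fg eq with _ , eq′ ← ·-injective eq =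
    contradiction eq′ (redex-not-≡-fireball G ff)
  decomposition-unique ⟨·⟩ ff (G ·ˡ _) fg eq with eq′ , _ ← ·-injective eq =
    contradiction eq′ (redex-not-≡-fireball G (value (ƛ _)))
  decomposition-unique (_ ·ʳ F) ff ⟨·⟩ fg eq with _ , eq′ ← ·-injective eq =
    contradiction (≡-sym eq′) (redex-not-≡-fireball F fg)
  decomposition-unique (_ ·ʳ F) ff (_ ·ʳ G) fg eq
    with refl , eq′ ← ·-injective eq
    with refl , refl , refl ← decomposition-unique F ff G fg eq′ = refl , refl , refl
  decomposition-unique (_ ·ʳ F) ff (_ ·ˡ fu) fg eq with _ , eq′ ← ·-injective eq =
    contradiction (≡-sym eq′) (redex-not-≡-fireball F fu)
  decomposition-unique (F ·ˡ _) ff ⟨·⟩ fg eq with eq′ , _ ← ·-injective eq =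
    contradiction (≡-sym eq′) (redex-not-≡-fireball F (value (ƛ _)))
  decomposition-unique (_ ·ˡ fu) ff (_ ·ʳ G) fg eq with _ , eq′ ← ·-injective eq =
    contradiction eq′ (redex-not-≡-fireball G fu)
  decomposition-unique (F ·ˡ _) ff (G ·ˡ _) fg eq
    with eq′ , refl ← ·-injective eq
    with refl , refl , refl ← decomposition-unique F ff G fg eq′ = refl , refl , refl

  atMostOneRedex : (s : Term n) → AtMostOneRedex s
  atMostOneRedex s r r′ =
    decomposition-unique (evalCtx r) (argFireball r) (evalCtx r′) (argFireball r′)
      (trans (≡-sym (decomposes r)) (decomposes r′))

  -- The sources are kept apart by an equation because matching both `step`s on a single source
  -- would require unifying two plugged contexts.
  →f-deterministic-≡ : s ≡ s′ → s →f t → s′ →f t′ → t ≡ t′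
  →f-deterministic-≡ eq (step F f) (step G g)
    with refl , refl , refl ← decomposition-unique F f G g eq = refl

  →f-deterministic : Deterministic _≡_ (_→f_ {n})
  →f-deterministic = →f-deterministic-≡ refl

theorem1 : (Sym : Set) → let open FireballCalculus Sym in
    ((n : ℕ) (t : Term n) → Closed t → IsNormalForm _→f_ t → Fireball t)
    ×
    ((n : ℕ) → ((s : Term n) → AtMostOneRedex s) × Deterministic _≡_ (_→f_ {n}))
theorem1 Sym =
  (λ n t → closed-normal⇒fireball) ,
  (λ n → atMostOneRedex , →f-deterministic)
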